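{- Let either $\Sigma=\mathcal F^\sharp_c$ and $S=\mathcal F$, or $\Sigma=\mathcal F^\sharp_c\cup\mathcal F^-$ and $S=\mathcal F^-$. Let $\mathcal J$ be an interpretation of the signature $\Sigma$ in a weakly monotonic algebra such that: - $\mathcal J$ maps each $\mathsf c_\sigma$ to $0_\sigma$; - for all $f:[\sigma_1\times\dots\times\sigma_m]\Rightarrow\tau_1\Rightarrow\dots\Rightarrow\tau_k\Rightarrow\iota\in S$ ($\iota$ a base type), all $1\le i\le m$ and all $n\in WM_{\sigma_i}$: $\mathcal J_f(0_{\sigma_1},\dots,n,\dots,0_{\sigma_m},0_{\tau_1},\dots,0_{\tau_k})\sqsupseteq_{wm}n(\vec 0)$ (with $n$ in the $i$-th position). Define $s\succeq t$ if $[\![s]\!]_{\mathcal J,\alpha}\sqsupseteq_{wm}[\![t]\!]_{\mathcal J,\alpha}$ for all valuations $\alpha$, and $s\succ t$ if $[\![s]\!]_{\mathcal J,\alpha}\sqsupset_{wm}[\![t]\!]_{\mathcal J,\alpha}$ for all valuations $\alpha$. Then $(\succeq,\succ)$ is a reduction pair which respects $\rhd^S$.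
   Context: **Types and terms.** Simple types are built from a set of base types with the right-associative constructor $\Rightarrow$. A type declaration is an expression $[\sigma_1\times\dots\times\sigma_n]\Rightarrow\tau$, $n\ge 0$. There are infinitely many variables of each type; function symbols each carry a type declaration. Terms over a set of function symbols are: variables $x:\sigma$; applications $s\cdot t:\tau$ for $s:\sigma\Rightarrow\tau$, $t:\sigma$ (left-associative); abstractions $\lambda x.s:\sigma\Rightarrow\tau$ for $x:\sigma$, $s:\tau$; functional terms $f(s_1,\dots,s_n):\tau$ for $f:[\sigma_1\times\dots\times\sigma_n]\Rightarrow\tau$, $s_i:\sigma_i$ ($\tau$ may be functional). Terms are modulo $\alpha$-conversion; substitutions are type-preserving, with finite domain, and capture-avoiding. A context $C[]$ is a term with one hole; filling it may capture variables. **Signature.** $\mathcal F$ is the set of function symbols of a given rewrite system, and $\mathcal D\subseteq\mathcal F$ its set of defined symbols (those $f$ for which some rule has a left-hand side of the form $f(l_1,\dots,l_n)\cdot l_{n+1}\cdots l_m$). $\mathcal F^\sharp_c$ extends $\mathcal F$ with a marked symbol $f^\sharp$ (same declaration as $f$) for each $f\in\mathcal D$ and a constant $\mathsf c_\sigma:\sigma$ for each type $\sigma$. $\mathcal F^-=\{f^-\mid f\in\mathcal F\}$ is a set of fresh copies with the same declarations. **Weakly monotonic functionals.** Let $\mathcal A=(A,\vee,0,>)$ where $A$ is a set, $\vee$ a binary operation on $A$, $0\in A$, and $>$ a well-founded partial order on $A$ with reflexive closure $\geq$, such that $a\ge 0$ for all $a\in A$, and $x\vee y\ge x$, $x\vee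 y\ge y$, $x\vee0=x$ for all $x,y\in A$. For a base type $\iota$: $WM_\iota=A$, $\sqsupset_{wm}$ is $>$ and $\sqsupseteq_{wm}$ is $\ge$. $WM_{\sigma\Rightarrow\tau}$ consists of the functions $f:WM_\sigma\to WM_\tau$ such that $x\sqsupseteq_{wm}y$ implies $f(x)\sqsupseteq_{wm}f(y)$; $f\sqsupset_{wm}g$ iff $f(x)\sqsupset_{wm}g(x)$ for all $x\in WM_\sigma$, and $f\sqsupseteq_{wm}g$ iff $f(x)\sqsupseteq_{wm}g(x)$ for all $x\in WM_\sigma$. (All base types are interpreted by the same set $A$, so that terms whose types differ only in the names of base types can be compared.) For $\sigma=\tau_1\Rightarrow\dots\Rightarrow\tau_k\Rightarrow\iota$, $0_\sigma\in WM_\sigma$ is the constant function with value $0$, and for $f\in WM_\sigma$, $f(\vec0)=f(0_{\tau_1},\dots,0_{\tau_k})\in A$. Define $\max_\iota(x,y)=x\vee y$ for $x,y\in A$, and $\max_{\sigma\Rightarrow\tau}(f,y)$ is the function $x\mapsto\max_\tau(f(x),y)$ for $f\in WM_{\sigma\Rightarrow\tau}$, $y\in A$. **Interpretations.** An interpretation $\mathcal J$ of a signature assigns to each $f:[\sigma_1\times\dots\times\sigma_n]\Rightarrow\tau$ an element $\mathcal J_f\in WM_{\sigma_1\Rightarrow\dots\Rightarrow\sigma_n\Rightarrow\tau}$; the pair $(\mathcal A,\mathcal J)$ is a weakly monotonic algebra. A valuation $\alpha$ maps finitely many variables $x:\sigma$ to elements of $WM_\sigma$ (in interpreting a term, $\alpha$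 is defined on all its free variables). $[\![x]\!]_{\mathcal J,\alpha}=\alpha(x)$; $[\![f(s_1,\dots,s_n)]\!]_{\mathcal J,\alpha}=\mathcal J_f([\![s_1]\!]_{\mathcal J,\alpha},\dots,[\![s_n]\!]_{\mathcal J,\alpha})$; $[\![\lambda x.s]\!]_{\mathcal J,\alpha}$ is the function $n\mapsto[\![s]\!]_{\mathcal J,\alpha\cup\{x\mapsto n\}}$ (with $x$ not in the domain of $\alpha$); $[\![s\cdot t]\!]_{\mathcal J,\alpha}=\max([\![s]\!]_{\mathcal J,\alpha}([\![t]\!]_{\mathcal J,\alpha}),\,[\![t]\!]_{\mathcal J,\alpha}(\vec0))$. **Reduction pairs.** A reduction pair is a quasi-ordering $\succeq$ and a well-founded ordering $\succ$ on terms over $\Sigma$ such that: $\succ\cdot\succeq\,\subseteq\,\succ$ or $\succeq\cdot\succ\,\subseteq\,\succ$; both are closed under substitution; $\succeq$ is monotonic (if $s\succeq t$ and $s,t$ have the same type then $C[s]\succeq C[t]$ for all contexts); and always $(\lambda x.s)\cdot t\succeq s[x:=t]$. **The relation $\rhd^S$.** $\rhd^S$ is the relation on base-type terms over $\Sigma$ (with reflexive closure $\unrhd^S$) generated by: $(\lambda x.s)\cdot t_0\cdots t_n\rhd^S u$ if $s[x:=t_0]\cdot t_1\cdots t_n\unrhd^S u$; $f(s_1,\dots,s_m)\cdot t_1\cdots t_n\unrhd^S u$ if $f\in S$ and $s_i\cdot\vec{\mathsf c}\unrhd^S u$ for some $i$; $s\cdot t_1\cdots t_n\unrhd^S u$ if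 $t_i\cdot\vec{\mathsf c}\unrhd^S u$ for some $i$ ($s$ of any form). Here $s\cdot\vec{\mathsf c}$ is $s$ applied to constants $\mathsf c_\sigma$ of the right types so as to obtain base type. $(\succeq,\succ)$ respects $\rhd^S$ if $\rhd^S\,\subseteq(\succeq\cup\succ)^*$.
   Formalization: The operation ∨ is additionally assumed weakly monotonic in both arguments; without this, interpretations of terms such as λx.z·x need not be weakly monotonic (e.g. on ℕ with ∨ the maximum except 1∨1=5), so the statement would be ill-defined. -}

module Defs where

open import Data.List.Base using (List; []; _∷_; foldr)
open import Data.List.Membership.Propositional using (_∈_)
open import Data.List.Relation.Unary.All using (All; []; _∷_; lookup; universal; _[_]≔_)
open import Data.Nat.Base using (ℕ)
open import Data.Product using (Σ; Σ-syntax; ∃; ∃-syntax; _×_; _,_; proj₁; proj₂)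
open import Data.Sum.Base using (_⊎_)
open import Data.Unit.Base using (⊤; tt)
open import Function.Base using (flip)
open import Induction.WellFounded using (WellFounded)
open import Level using (0ℓ)
open import Relation.Binary.Construct.Closure.Reflexive using (ReflClosure; refl)
import Relation.Binary.Construct.Closure.Reflexive.Properties as Refl
open import Relation.Binary.Construct.Closure.ReflexiveTransitive using (Star)
open import Relation.Binary.Construct.Union using (_∪_)
open import Relation.Binary.Core using (Rel)
open import Relation.Binary.Structures using (IsPreorder; IsStrictPartialOrder)
open import Relation.Binary.PropositionalEquality.Core using (_≡_; subst)

------------------------------------------------------------------------
-- Types

infixr 6 _⇒_ _⇒*_

data Ty (B : Set) : Set where
  base : B → Ty B
  _⇒_  : Ty B → Ty B → Ty B

_⇒*_ : {B : Set} → List (Ty B) → Ty B → Ty B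
σs ⇒* τ = foldr _⇒_ τ σs

-- Every type σ is  inputs σ ⇒* base (output σ).

inputs : {B : Set} → Ty B → List (Ty B)
inputs (base ι) = []
inputs (σ ⇒ τ)  = σ ∷ inputs τ

output : {B : Set} → Ty B → B
output (base ι) = ι
output (σ ⇒ τ)  = output τ

-- A type with the names of its base types forgotten.

Shape : Set
Shape = Ty ⊤

shape : {B : Set} → Ty B → Shape
shape (base ι) = base tt
shape (σ ⇒ τ)  = shape σ ⇒ shape τ

------------------------------------------------------------------------
-- Terms

-- The symbol f has type declaration [dom f] ⇒ cod f.

record Signature (B : Set) : Set₁ where
  field
    Sym : Set
    dom : Sym → List (Ty B)
    cod : Sym → Ty B

open Signature public

-- A scope lists the variables captured by the enclosing abstractions (as
-- de Bruijn indices).  In every scope there are, in addition, infinitely many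
-- variables `free n` of each type.

Scope : Set → Set
Scope B = List (Ty B)

data Var {B : Set} : Scope B → Ty B → Set where
  free  : ∀ {σ} → ℕ → Var [] σ
  here  : ∀ {Γ σ} → Var (σ ∷ Γ) σ
  there : ∀ {Γ σ τ} → Var Γ τ → Var (σ ∷ Γ) τ

infixl 7 _·_

data Tm {B : Set} (F : Signature B) (Γ : Scope B) : Ty B → Set where
  var : ∀ {σ} → Var Γ σ → Tm F Γ σ
  _·_ : ∀ {σ τ} → Tm F Γ (σ ⇒ τ) → Tm F Γ σ → Tm F Γ τ
  lam : ∀ {σ τ} → Tm F (σ ∷ Γ) τ → Tm F Γ (σ ⇒ τ)
  fun : (f : Sym F) → All (Tm F Γ) (dom F f) → Tm F Γ (cod F f)

module _ {B : Set} {F : Signature B} where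

  -- Application of s to exactly as many arguments as give a base-type term.

  infixl 7 _·*_

  _·*_ : ∀ {Γ σ} → Tm F Γ σ → All (Tm F Γ) (inputs σ) → Tm F Γ (base (output σ))
  _·*_ {σ = base ι} s []       = s
  _·*_ {σ = σ ⇒ τ}  s (t ∷ ts) = (s · t) ·* ts

  Ren : Scope B → Scope B → Set
  Ren Γ Δ = ∀ τ → Var Γ τ → Var Δ τ

  liftᵣ : ∀ {Γ Δ σ} → Ren Γ Δ → Ren (σ ∷ Γ) (σ ∷ Δ)
  liftᵣ ρ _ here      = here
  liftᵣ ρ τ (there x) = there (ρ τ x)

  mutual
    ren : ∀ {Γ Δ σ} → Ren Γ Δ → Tm F Γ σ → Tm F Δ σ
    ren ρ (var x)    = var (ρ _ x)
    ren ρ (s · t)    = ren ρ s · ren ρ t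
    ren ρ (lam s)    = lam (ren (liftᵣ ρ) s)
    ren ρ (fun f ss) = fun f (rens ρ ss)

    rens : ∀ {Γ Δ σs} → Ren Γ Δ → All (Tm F Γ) σs → All (Tm F Δ) σs
    rens ρ []       = []
    rens ρ (s ∷ ss) = ren ρ s ∷ rens ρ ss

  -- No finite-domain condition is imposed: a term has finitely many variables,
  -- so on any given terms a substitution acts like one of finite domain.

  Sub : Scope B → Scope B → Set
  Sub Γ Δ = ∀ τ → Var Γ τ → Tm F Δ τ

  liftₛ : ∀ {Γ Δ σ} → Sub Γ Δ → Sub (σ ∷ Γ) (σ ∷ Δ)
  liftₛ γ _ here      = var here
  liftₛ γ τ (there x) = ren (λ _ → there) (γ τ x)

  mutual
    sub : ∀ {Γ Δ σ} → Sub Γ Δ → Tm F Γ σ → Tm F Δ σ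
    sub γ (var x)    = γ _ x
    sub γ (s · t)    = sub γ s · sub γ t
    sub γ (lam s)    = lam (sub (liftₛ γ) s)
    sub γ (fun f ss) = fun f (subs γ ss)

    subs : ∀ {Γ Δ σs} → Sub Γ Δ → All (Tm F Γ) σs → All (Tm F Δ) σs
    subs γ []       = []
    subs γ (s ∷ ss) = sub γ s ∷ subs γ ss

  instantiate : ∀ {Γ σ} → Tm F Γ σ → Sub (σ ∷ Γ) Γ
  instantiate t _ here      = t
  instantiate t _ (there x) = var x

  infix 8 _[≔_]

  _[≔_] : ∀ {Γ σ τ} → Tm F (σ ∷ Γ) τ → Tm F Γ σ → Tm F Γ τ
  s [≔ t ] = sub (instantiate t) s

-- Context F Δ υ Γ σ: contexts of type σ in scope Γ, whose hole has type υ.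
-- The scope Δ of the hole extends Γ by the variables captured by the context.

data Context {B : Set} (F : Signature B) (Δ : Scope B) (υ : Ty B) :
             Scope B → Ty B → Set where
  □    : Context F Δ υ Δ υ
  _·ˡ_ : ∀ {Γ σ τ} → Context F Δ υ Γ (σ ⇒ τ) → Tm F Γ σ → Context F Δ υ Γ τ
  _·ʳ_ : ∀ {Γ σ τ} → Tm F Γ (σ ⇒ τ) → Context F Δ υ Γ σ → Context F Δ υ Γ τ
  lam  : ∀ {Γ σ τ} → Context F Δ υ (σ ∷ Γ) τ → Context F Δ υ Γ (σ ⇒ τ)
  -- The argument of f at position i is the context; the term that ss has at
  -- that position is irrelevant.
  fun  : ∀ {Γ σ} (f : Sym F) (ss : All (Tm F Γ) (dom F f)) (i : σ ∈ dom F f) →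
         Context F Δ υ Γ σ → Context F Δ υ Γ (cod F f)

plug : {B : Set} {F : Signature B} {Δ Γ : Scope B} {υ σ : Ty B} →
       Context F Δ υ Γ σ → Tm F Δ υ → Tm F Γ σ
plug □              u = u
plug (C ·ˡ t)       u = plug C u · t
plug (s ·ʳ C)       u = s · plug C u
plug (lam C)        u = lam (plug C u)
plug (fun f ss i C) u = fun f (ss [ i ]≔ plug C u)

------------------------------------------------------------------------
-- Reduction pairs

-- Terms of possibly different types can be related.

TermRel : {B : Set} → Signature B → Set₁
TermRel F = ∀ Γ → Rel (∃ (Tm F Γ)) 0ℓ

record IsReductionPair {B : Set} {F : Signature B} (_⊢_⪰_ _⊢_≻_ : TermRel F) : Set where
  field
    quasiOrder  : ∀ Γ → IsPreorder _≡_ (Γ ⊢_⪰_)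
    strictOrder : ∀ Γ → IsStrictPartialOrder _≡_ (Γ ⊢_≻_)
    wellFounded : ∀ Γ → WellFounded (flip (Γ ⊢_≻_))
    compatible  : (∀ Γ s t u → Γ ⊢ s ≻ t → Γ ⊢ t ⪰ u → Γ ⊢ s ≻ u)
                ⊎ (∀ Γ s t u → Γ ⊢ s ⪰ t → Γ ⊢ t ≻ u → Γ ⊢ s ≻ u)
    ⪰-sub       : ∀ {Γ Δ σ τ} (γ : Sub Γ Δ) (s : Tm F Γ σ) (t : Tm F Γ τ) →
                  Γ ⊢ (σ , s) ⪰ (τ , t) → Δ ⊢ (σ , sub γ s) ⪰ (τ , sub γ t)
    ≻-sub       : ∀ {Γ Δ σ τ} (γ : Sub Γ Δ) (s : Tm F Γ σ) (t : Tm F Γ τ) →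
                  Γ ⊢ (σ , s) ≻ (τ , t) → Δ ⊢ (σ , sub γ s) ≻ (τ , sub γ t)
    ⪰-mono      : ∀ {Γ Δ υ σ} (C : Context F Δ υ Γ σ) (s t : Tm F Δ υ) →
                  Δ ⊢ (υ , s) ⪰ (υ , t) → Γ ⊢ (σ , plug C s) ⪰ (σ , plug C t)
    ⪰-beta      : ∀ {Γ σ τ} (s : Tm F (σ ∷ Γ) τ) (t : Tm F Γ σ) →
                  Γ ⊢ (τ , lam s · t) ⪰ (τ , s [≔ t ])

------------------------------------------------------------------------
-- Rewrite systems and their extended signatures

record RewriteSystem (B : Set) : Set₁ where
  field
    𝓕    : Signature B
    Rule : ∀ {σ} → Tm 𝓕 [] σ → Tm 𝓕 [] σ → Set

  -- Rules relate terms over the free variables only.  HeadedBy f l: the term l has the form f(l₁,…,lₙ) · lₙ₊₁ ⋯ lₘ.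
  data HeadedBy (f : Sym 𝓕) : ∀ {σ} → Tm 𝓕 [] σ → Set where
    fun : ∀ ls → HeadedBy f (fun f ls)
    _·_ : ∀ {σ τ} {s : Tm 𝓕 [] (σ ⇒ τ)} → HeadedBy f s → ∀ l → HeadedBy f (s · l)

  Defined : Sym 𝓕 → Set
  Defined f = ∃[ σ ] Σ[ l ∈ Tm 𝓕 [] σ ] Σ[ r ∈ Tm 𝓕 [] σ ] (Rule l r × HeadedBy f l)

open RewriteSystem public

-- plain:   Σ = 𝓕♯c        and  S = 𝓕
-- tagged:  Σ = 𝓕♯c ∪ 𝓕⁻   and  S = 𝓕⁻

data Variant : Set where
  plain tagged : Variant

module _ {B : Set} (R : RewriteSystem B) where

  -- The proof in `marked` is irrelevant, so that each defined symbol has just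
  -- one marked copy.
  data ExtSym : Variant → Set where
    orig   : ∀ {v} → Sym (𝓕 R) → ExtSym v
    marked : ∀ {v} (f : Sym (𝓕 R)) → .(Defined R f) → ExtSym v
    const  : ∀ {v} → Ty B → ExtSym v
    minus  : Sym (𝓕 R) → ExtSym tagged

  extDom : ∀ {v} → ExtSym v → List (Ty B)
  extDom (orig f)     = dom (𝓕 R) f
  extDom (marked f _) = dom (𝓕 R) f
  extDom (const σ)    = []
  extDom (minus f)    = dom (𝓕 R) f

  extCod : ∀ {v} → ExtSym v → Ty B
  extCod (orig f)     = cod (𝓕 R) f
  extCod (marked f _) = cod (𝓕 R) f
  extCod (const σ)    = σ
  extCod (minus f)    = cod (𝓕 R) f

  ExtSig : Variant → Signature B
  ExtSig v = record { Sym = ExtSym v ; dom = extDom ; cod = extCod }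

  data InS : ∀ v → ExtSym v → Set where
    orig  : (f : Sym (𝓕 R)) → InS plain (orig f)
    minus : (f : Sym (𝓕 R)) → InS tagged (minus f)

------------------------------------------------------------------------
-- The relation ▷ˢ

module _ {B : Set} (R : RewriteSystem B) (v : Variant) where

  BaseTm : Scope B → Set
  BaseTm Γ = Σ[ ι ∈ B ] Tm (ExtSig R v) Γ (base ι)

  term : ∀ {Γ} → BaseTm Γ → ∃ (Tm (ExtSig R v) Γ)
  term (ι , s) = base ι , s

  _·c⃗ : ∀ {Γ σ} → Tm (ExtSig R v) Γ σ → Tm (ExtSig R v) Γ (base (output σ))
  s ·c⃗ = s ·* universal (λ σ → fun (const σ) []) _

  infix 4 _▷ˢ_ _⊵ˢ_

  mutual
    data _▷ˢ_ {Γ : Scope B} : Rel (BaseTm Γ) 0ℓ where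
      beta  : ∀ {σ τ u} (s : Tm (ExtSig R v) (σ ∷ Γ) τ) (t : Tm (ExtSig R v) Γ σ)
                (ts : All (Tm (ExtSig R v) Γ) (inputs τ)) →
              (_ , s [≔ t ] ·* ts) ⊵ˢ u →
              (_ , (lam s · t) ·* ts) ▷ˢ u
      inFun : ∀ {f σ u} → InS R v f →
              (ss : All (Tm (ExtSig R v) Γ) (extDom R f))
                (ts : All (Tm (ExtSig R v) Γ) (inputs (extCod R f))) (i : σ ∈ extDom R f) →
              (_ , lookup ss i ·c⃗) ⊵ˢ u →
              (_ , fun f ss ·* ts) ▷ˢ u
      inArg : ∀ {σ τ u} (s : Tm (ExtSig R v) Γ σ)
                (ts : All (Tm (ExtSig R v) Γ) (inputs σ)) (i : τ ∈ inputs σ) →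
              (_ , lookup ts i ·c⃗) ⊵ˢ u →
              (_ , s ·* ts) ▷ˢ u

    _⊵ˢ_ : ∀ {Γ} → Rel (BaseTm Γ) 0ℓ
    _⊵ˢ_ = ReflClosure _▷ˢ_

  RespectsSubterm : (_⊢_⪰_ _⊢_≻_ : TermRel (ExtSig R v)) → Set
  RespectsSubterm _⊢_⪰_ _⊢_≻_ =
    ∀ Γ (s u : BaseTm Γ) → s ▷ˢ u → Star ((Γ ⊢_⪰_) ∪ (Γ ⊢_≻_)) (term s) (term u)

------------------------------------------------------------------------
-- Weakly monotonic functionals

record Domain : Set₁ where
  infix  4 _>_ _≥_
  infixr 6 _∨_
  field
    A     : Set
    _∨_   : A → A → A
    𝟎     : A
    _>_   : Rel A 0ℓ

  _≥_ : Rel A 0ℓ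
  _≥_ = ReflClosure _>_

  field
    >-isStrictPartialOrder : IsStrictPartialOrder _≡_ _>_
    >-wellFounded          : WellFounded (flip _>_)
    ≥𝟎                     : ∀ x → x ≥ 𝟎
    x∨y≥x                  : ∀ x y → x ∨ y ≥ x
    x∨y≥y                  : ∀ x y → x ∨ y ≥ y
    x∨𝟎≡x                  : ∀ x → x ∨ 𝟎 ≡ x
    -- Needed, and sufficient, for max and the interpretation of terms to yield
    -- weakly monotonic functionals at all: it says that λx.λy. x ∨ y is one.
    ∨-mono                 : ∀ {x x′ y y′} → x ≥ x′ → y ≥ y′ → x ∨ y ≥ x′ ∨ y′

module Functionals (𝒜 : Domain) where
  open Domain 𝒜 public

  infix 4 _∋_⊒_ _∋_⊐_ _∋_≐_

  -- Indexed by shapes, since all base types are interpreted by A.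
  mutual
    WM : Shape → Set
    WM (base _) = A
    WM (σ ⇒ τ)  = Σ[ f ∈ (WM σ → WM τ) ] (∀ x y → σ ∋ x ⊒ y → τ ∋ f x ⊒ f y)

    _∋_⊒_ : ∀ σ → Rel (WM σ) 0ℓ
    base _ ∋ x ⊒ y  = x ≥ y
    (σ ⇒ τ) ∋ f ⊒ g = ∀ x → τ ∋ proj₁ f x ⊒ proj₁ g x

  _∋_⊐_ : ∀ σ → Rel (WM σ) 0ℓ
  base _ ∋ x ⊐ y  = x > y
  (σ ⇒ τ) ∋ f ⊐ g = ∀ x → τ ∋ proj₁ f x ⊐ proj₁ g x

  -- Extensional equality of functionals.
  _∋_≐_ : ∀ σ → Rel (WM σ) 0ℓ
  base _ ∋ x ≐ y  = x ≡ y
  (σ ⇒ τ) ∋ f ≐ g = ∀ x → τ ∋ proj₁ f x ≐ proj₁ g x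

  ⊒-refl : ∀ σ x → σ ∋ x ⊒ x
  ⊒-refl (base _) x = refl
  ⊒-refl (σ ⇒ τ)  f = λ x → ⊒-refl τ (proj₁ f x)

  ⊒-trans : ∀ σ {x y z} → σ ∋ x ⊒ y → σ ∋ y ⊒ z → σ ∋ x ⊒ z
  ⊒-trans (base _) p q = Refl.trans (IsStrictPartialOrder.trans >-isStrictPartialOrder) p q
  ⊒-trans (σ ⇒ τ)  p q = λ x → ⊒-trans τ (p x) (q x)

  zeroAt : ∀ σ → WM σ
  zeroAt (base _) = 𝟎
  zeroAt (σ ⇒ τ)  = (λ _ → zeroAt τ) , (λ _ _ _ → ⊒-refl τ (zeroAt τ))

  -- f(0⃗)
  at0⃗ : ∀ {σ} → WM σ → A
  at0⃗ {base _} x = x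
  at0⃗ {σ ⇒ τ}  f = at0⃗ {τ} (proj₁ f (zeroAt σ))

  at0⃗-mono : ∀ σ {x y} → σ ∋ x ⊒ y → at0⃗ {σ} x ≥ at0⃗ {σ} y
  at0⃗-mono (base _) p = p
  at0⃗-mono (σ ⇒ τ)  p = at0⃗-mono τ (p (zeroAt σ))

  mutual
    max : ∀ σ → WM σ → A → WM σ
    max (base _) x y = x ∨ y
    max (σ ⇒ τ)  f y = (λ x → max τ (proj₁ f x) y)
                     , (λ x x′ p → max-mono τ (proj₂ f x x′ p) refl)

    max-mono : ∀ σ {f g y z} → σ ∋ f ⊒ g → y ≥ z → σ ∋ max σ f y ⊒ max σ g z
    max-mono (base _) p q = ∨-mono p q
    max-mono (σ ⇒ τ)  p q = λ x → max-mono τ (p x) q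

------------------------------------------------------------------------
-- Interpretations

module _ (𝒜 : Domain) {B : Set} where
  open Functionals 𝒜

  ⟪_⟫ : Ty B → Set
  ⟪ σ ⟫ = WM (shape σ)

  Interpretation : Signature B → Set
  Interpretation F = (f : Sym F) → ⟪ dom F f ⇒* cod F f ⟫

  apply : ∀ σs {τ} → ⟪ σs ⇒* τ ⟫ → All ⟪_⟫ σs → ⟪ τ ⟫
  apply []       f []       = f
  apply (σ ∷ σs) f (x ∷ xs) = apply σs (proj₁ f x) xs

  zeros : ∀ σs → All ⟪_⟫ σs
  zeros = universal (λ σ → zeroAt (shape σ))

  -- Total on the variables of a scope: values at variables that do not occur in
  -- a term have no influence on its interpretation.
  Valuation : Scope B → Set
  Valuation Γ = ∀ τ → Var Γ τ → ⟪ τ ⟫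

  infixl 5 _▸_

  _▸_ : ∀ {Γ σ} → Valuation Γ → ⟪ σ ⟫ → Valuation (σ ∷ Γ)
  (α ▸ n) _ here      = n
  (α ▸ n) τ (there x) = α τ x

  data Args⊒ : ∀ {σs} → Rel (All ⟪_⟫ σs) 0ℓ where
    []  : Args⊒ [] []
    _∷_ : ∀ {σ σs x y} {xs ys : All ⟪_⟫ σs} →
          shape σ ∋ x ⊒ y → Args⊒ xs ys → Args⊒ {σ ∷ σs} (x ∷ xs) (y ∷ ys)

  apply-mono : ∀ σs {τ} (f : ⟪ σs ⇒* τ ⟫) {xs ys} → Args⊒ xs ys →
               shape τ ∋ apply σs {τ} f xs ⊒ apply σs {τ} f ys
  apply-mono []            f []       = ⊒-refl _ f
  apply-mono (σ ∷ σs) {τ} f (p ∷ ps) = go σs (proj₂ f _ _ p) ps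
    where
    go : ∀ σs {g h : ⟪ σs ⇒* τ ⟫} {xs ys} → shape (σs ⇒* τ) ∋ g ⊒ h → Args⊒ xs ys →
         shape τ ∋ apply σs {τ} g xs ⊒ apply σs {τ} h ys
    go []       q []                           = q
    go (σ ∷ σs) {g} {h} {x ∷ _} {y ∷ _} q (p ∷ ps) =
      go σs (⊒-trans (shape (σs ⇒* τ)) (q x) (proj₂ h x y p)) ps

  _≽_ : ∀ {Γ} → Rel (Valuation Γ) 0ℓ
  α ≽ β = ∀ τ x → shape τ ∋ α τ x ⊒ β τ x

  ▸-mono : ∀ {Γ σ} {α β : Valuation Γ} {m n : ⟪ σ ⟫} →
           α ≽ β → shape σ ∋ m ⊒ n → (_▸_ {σ = σ} α m) ≽ (_▸_ {σ = σ} β n)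
  ▸-mono p q _ here      = q
  ▸-mono p q τ (there x) = p τ x

  module _ (F : Signature B) (J : Interpretation F) where

    mutual
      ⟦_⟧ : ∀ {Γ σ} → Tm F Γ σ → Valuation Γ → ⟪ σ ⟫
      ⟦ var x ⟧ α             = α _ x
      ⟦ _·_ {σ} {τ} s t ⟧ α   = max (shape τ) (proj₁ (⟦ s ⟧ α) (⟦ t ⟧ α))
                                              (at0⃗ {shape σ} (⟦ t ⟧ α))
      ⟦ lam {σ} s ⟧ α         = (λ n → ⟦ s ⟧ (_▸_ {σ = σ} α n))
                              , (λ m n p → ⟦ s ⟧-mono (▸-mono (λ τ x → ⊒-refl _ (α τ x)) p))
      ⟦ fun f ss ⟧ α          = apply (dom F f) {cod F f} (J f) (⟦ ss ⟧* α)

      ⟦_⟧* : ∀ {Γ σs} → All (Tm F Γ) σs → Valuation Γ → All ⟪_⟫ σs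
      ⟦ [] ⟧* α     = []
      ⟦ s ∷ ss ⟧* α = ⟦ s ⟧ α ∷ ⟦ ss ⟧* α

      ⟦_⟧-mono : ∀ {Γ σ} (s : Tm F Γ σ) {α β : Valuation Γ} → α ≽ β →
                 shape σ ∋ ⟦ s ⟧ α ⊒ ⟦ s ⟧ β
      ⟦ var x ⟧-mono p                     = p _ x
      ⟦ _·_ {σ} {τ} s t ⟧-mono {α} {β} p   =
        max-mono (shape τ)
          (⊒-trans (shape τ) (⟦ s ⟧-mono p (⟦ t ⟧ α)) (proj₂ (⟦ s ⟧ β) _ _ (⟦ t ⟧-mono p)))
          (at0⃗-mono (shape σ) (⟦ t ⟧-mono p))
      ⟦ lam {σ} s ⟧-mono p                 = λ n → ⟦ s ⟧-mono (▸-mono p (⊒-refl (shape σ) n))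
      ⟦ fun f ss ⟧-mono p                  = apply-mono (dom F f) {cod F f} (J f) (⟦ ss ⟧*-mono p)

      ⟦_⟧*-mono : ∀ {Γ σs} (ss : All (Tm F Γ) σs) {α β : Valuation Γ} → α ≽ β →
                  Args⊒ (⟦ ss ⟧* α) (⟦ ss ⟧* β)
      ⟦ [] ⟧*-mono p     = []
      ⟦ s ∷ ss ⟧*-mono p = ⟦ s ⟧-mono p ∷ ⟦ ss ⟧*-mono p

    -- Terms are comparable when their types agree up to the names of base types.

    Geq : TermRel F
    Geq Γ (σ , s) (τ , t) =
      Σ[ e ∈ shape σ ≡ shape τ ] (∀ α → shape τ ∋ subst WM e (⟦ s ⟧ α) ⊒ ⟦ t ⟧ α)

    Gt : TermRel F
    Gt Γ (σ , s) (τ , t) =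
      Σ[ e ∈ shape σ ≡ shape τ ] (∀ α → shape τ ∋ subst WM e (⟦ s ⟧ α) ⊐ ⟦ t ⟧ α)

{-# OPTIONS --safe #-}
-- Substitution commutes with interpretation only up to mutual ⊒: functionals
-- carry monotonicity proofs and there is no function extensionality.  This
-- suffices, since both ⊒ and ⊐ are invariant under it.  For well-foundedness,
-- evaluating at the zero valuation and then at 0⃗ maps ≻ into the well-founded >.
-- For ▷ˢ, the maximum in ⟦ s · t ⟧ makes a base-type term s · t⃗ dominate both
-- ⟦ s ⟧(0⃗) and every ⟦ tᵢ ⟧(0⃗), while ⟦ s · c⃗ ⟧ is at most ⟦ s ⟧(0⃗).
module Submission where

open import Defs
open import Data.List.Base using (List; _∷_)
open import Data.List.Membership.Propositional using (_∈_)
open import Data.List.Relation.Unary.All using (All; []; _∷_; lookup; universal; _[_]≔_)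
open import Data.List.Relation.Unary.Any using (here; there)
open import Data.Product using (∃; _×_; _,_; proj₁; proj₂)
import Data.Product as Product
open import Data.Sum.Base using (inj₁)
open import Data.Unit.Base using (tt)
open import Function.Base using (flip)
open import Induction.WellFounded using (WellFounded; module Subrelation)
import Relation.Binary.Construct.On as On
open import Relation.Binary.Construct.Closure.Reflexive using ([_]; refl)
open import Relation.Binary.Construct.Closure.ReflexiveTransitive using (ε; _◅_)
open import Relation.Binary.Core using (Rel)
open import Relation.Binary.PropositionalEquality
  using (_≡_; refl; sym; trans; subst; isEquivalence; resp₂)
open import Relation.Binary.Structures using (IsStrictPartialOrder)

module _ (𝒜 : Domain) where
  open Functionals 𝒜
  private module > = IsStrictPartialOrder >-isStrictPartialOrder

  -- Order properties of weakly monotonic functionals.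

  infix 4 _∋_≈_

  _∋_≈_ : ∀ σ → Rel (WM σ) _
  σ ∋ x ≈ y = σ ∋ x ⊒ y × σ ∋ y ⊒ x

  ≈-refl : ∀ σ x → σ ∋ x ≈ x
  ≈-refl σ x = ⊒-refl σ x , ⊒-refl σ x

  ≐⇒⊑ : ∀ σ {x y} → σ ∋ x ≐ y → σ ∋ y ⊒ x
  ≐⇒⊑ (base _) refl = refl
  ≐⇒⊑ (σ ⇒ τ)  p    = λ x → ≐⇒⊑ τ (p x)

  ⊒-zeroAt : ∀ σ x → σ ∋ x ⊒ zeroAt σ
  ⊒-zeroAt (base _) x = ≥𝟎 x
  ⊒-zeroAt (σ ⇒ τ)  f = λ x → ⊒-zeroAt τ (proj₁ f x)

  at0⃗-zeroAt : ∀ σ → at0⃗ {σ} (zeroAt σ) ≡ 𝟎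
  at0⃗-zeroAt (base _) = refl
  at0⃗-zeroAt (σ ⇒ τ)  = at0⃗-zeroAt τ

  max-⊒ : ∀ σ x a → σ ∋ max σ x a ⊒ x
  max-⊒ (base _) x a = x∨y≥x x a
  max-⊒ (σ ⇒ τ)  f a = λ x → max-⊒ τ (proj₁ f x) a

  at0⃗-max-≥ : ∀ σ x a → at0⃗ {σ} (max σ x a) ≥ a
  at0⃗-max-≥ (base _) x a = x∨y≥y x a
  at0⃗-max-≥ (σ ⇒ τ)  f a = at0⃗-max-≥ τ (proj₁ f (zeroAt σ)) a

  -- An argument that vanishes at 0⃗ thus does not raise the value of an application through the
  -- maximum.
  ⊒-max-𝟎 : ∀ σ x → σ ∋ x ⊒ max σ x 𝟎
  ⊒-max-𝟎 (base _) x rewrite x∨𝟎≡x x = refl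
  ⊒-max-𝟎 (σ ⇒ τ)  f = λ x → ⊒-max-𝟎 τ (proj₁ f x)

  -- `f` and `g` are explicit because `⊒` at a function type mentions only their first projections,
  -- from which their monotonicity proofs cannot be inferred.
  app-mono : ∀ σ τ (f g : WM (σ ⇒ τ)) {x y} → (σ ⇒ τ) ∋ f ⊒ g → σ ∋ x ⊒ y →
             τ ∋ max τ (proj₁ f x) (at0⃗ {σ} x) ⊒ max τ (proj₁ g y) (at0⃗ {σ} y)
  app-mono σ τ f g {x} {y} p q =
    max-mono τ (⊒-trans τ (p x) (proj₂ g x y q)) (at0⃗-mono σ q)

  app-≈ : ∀ σ τ (f g : WM (σ ⇒ τ)) {x y} → (σ ⇒ τ) ∋ f ≈ g → σ ∋ x ≈ y →
          τ ∋ max τ (proj₁ f x) (at0⃗ {σ} x) ≈ max τ (proj₁ g y) (at0⃗ {σ} y)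
  app-≈ σ τ f g (p , p′) (q , q′) = app-mono σ τ f g p q , app-mono σ τ g f p′ q′

  ⊐-trans : ∀ σ {x y z} → σ ∋ x ⊐ y → σ ∋ y ⊐ z → σ ∋ x ⊐ z
  ⊐-trans (base _) p q = >.trans p q
  ⊐-trans (σ ⇒ τ)  p q = λ x → ⊐-trans τ (p x) (q x)

  ⊐-⊒-trans : ∀ σ {x y z} → σ ∋ x ⊐ y → σ ∋ y ⊒ z → σ ∋ x ⊐ z
  ⊐-⊒-trans (base _) p [ q ] = >.trans p q
  ⊐-⊒-trans (base _) p refl  = p
  ⊐-⊒-trans (σ ⇒ τ)  p q     = λ x → ⊐-⊒-trans τ (p x) (q x)

  ⊒-⊐-trans : ∀ σ {x y z} → σ ∋ x ⊒ y → σ ∋ y ⊐ z → σ ∋ x ⊐ z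
  ⊒-⊐-trans (base _) [ p ] q = >.trans p q
  ⊒-⊐-trans (base _) refl  q = q
  ⊒-⊐-trans (σ ⇒ τ)  p q     = λ x → ⊒-⊐-trans τ (p x) (q x)

  at0⃗-mono-> : ∀ σ {x y} → σ ∋ x ⊐ y → at0⃗ {σ} x > at0⃗ {σ} y
  at0⃗-mono-> (base _) p = p
  at0⃗-mono-> (σ ⇒ τ)  p = at0⃗-mono-> τ (p (zeroAt σ))

  at0⃗-subst : ∀ {σ τ} (e : σ ≡ τ) x → at0⃗ {τ} (subst WM e x) ≡ at0⃗ {σ} x
  at0⃗-subst refl x = refl

  -- Holds by uniqueness of identity proofs. It removes the transport from a `Geq` proof between
  -- terms of one type.
  subst-loop : ∀ {σ} (e : σ ≡ σ) x → subst WM e x ≡ x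
  subst-loop refl x = refl

  subst-⊒ : ∀ {σ τ} (e : σ ≡ τ) {x y} → σ ∋ x ⊒ y → τ ∋ subst WM e x ⊒ subst WM e y
  subst-⊒ refl p = p

  subst-⊐ : ∀ {σ τ} (e : σ ≡ τ) {x y} → σ ∋ x ⊐ y → τ ∋ subst WM e x ⊐ subst WM e y
  subst-⊐ refl p = p

  subst-trans : ∀ {σ τ υ} (e : σ ≡ τ) (e′ : τ ≡ υ) x →
                subst WM (trans e e′) x ≡ subst WM e′ (subst WM e x)
  subst-trans refl refl x = refl

  Args⊒-refl : ∀ {B : Set} {σs : List (Ty B)} (xs : All (λ σ → WM (shape σ)) σs) →
               Args⊒ 𝒜 xs xs
  Args⊒-refl []                 = []
  Args⊒-refl (_∷_ {x = σ} x xs) = ⊒-refl (shape σ) x ∷ Args⊒-refl xs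

  Args⊒-zeros : ∀ {B : Set} {σs : List (Ty B)} (xs : All (λ σ → WM (shape σ)) σs) →
                Args⊒ 𝒜 xs (zeros 𝒜 σs)
  Args⊒-zeros []                 = []
  Args⊒-zeros (_∷_ {x = σ} x xs) = ⊒-zeroAt (shape σ) x ∷ Args⊒-zeros xs

  module _ {B : Set} (F : Signature B) (J : Interpretation 𝒜 F) where
    private
      ⟦_⟧ₜ : ∀ {Γ σ} → Tm F Γ σ → Valuation 𝒜 Γ → WM (shape σ)
      ⟦_⟧ₜ = ⟦_⟧ 𝒜 F J

      ⟦_⟧ₐ : ∀ {Γ σs} → All (Tm F Γ) σs → Valuation 𝒜 Γ → All (λ σ → WM (shape σ)) σs
      ⟦_⟧ₐ = ⟦_⟧* 𝒜 F J

      _≽ᵍ_ _≻ᵍ_ : ∀ {Γ} → Rel (∃ (Tm F Γ)) _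
      _≽ᵍ_ {Γ} = Geq 𝒜 F J Γ
      _≻ᵍ_ {Γ} = Gt 𝒜 F J Γ

    -- Interpretation of renamings, substitutions and contexts.

    mutual
      -- Relating `α` and `β` only pointwise lets the induction pass under `lam`, where extending a
      -- composed valuation and composing with a lifted renaming agree only variable by variable.
      ⟦ren⟧ : ∀ {Γ Δ σ} (ρ : Ren {F = F} Γ Δ) (s : Tm F Γ σ) {α β} →
              (∀ τ x → shape τ ∋ α τ (ρ τ x) ≈ β τ x) →
              shape σ ∋ ⟦ ren ρ s ⟧ₜ α ≈ ⟦ s ⟧ₜ β
      ⟦ren⟧ ρ (var x) p = p _ x
      ⟦ren⟧ ρ (_·_ {σ} {τ} s t) {α} {β} p =
        app-≈ (shape σ) (shape τ) (⟦ ren ρ s ⟧ₜ α) (⟦ s ⟧ₜ β) (⟦ren⟧ ρ s p) (⟦ren⟧ ρ t p)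
      ⟦ren⟧ ρ (lam s) p = (λ n → proj₁ (body n)) , (λ n → proj₂ (body n))
        where
        body : ∀ n → _
        body n = ⟦ren⟧ (liftᵣ ρ) s λ where
          τ here      → ≈-refl (shape τ) n
          τ (there x) → p τ x
      ⟦ren⟧ ρ (fun f ss) p =
        let q , q′ = ⟦rens⟧ ρ ss p in
        apply-mono 𝒜 (dom F f) {cod F f} (J f) q , apply-mono 𝒜 (dom F f) {cod F f} (J f) q′

      ⟦rens⟧ : ∀ {Γ Δ σs} (ρ : Ren {F = F} Γ Δ) (ss : All (Tm F Γ) σs) {α β} →
               (∀ τ x → shape τ ∋ α τ (ρ τ x) ≈ β τ x) →
               Args⊒ 𝒜 (⟦ rens ρ ss ⟧ₐ α) (⟦ ss ⟧ₐ β) × Args⊒ 𝒜 (⟦ ss ⟧ₐ β) (⟦ rens ρ ss ⟧ₐ α)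
      ⟦rens⟧ ρ []       p = [] , []
      ⟦rens⟧ ρ (s ∷ ss) p = Product.zip _∷_ _∷_ (⟦ren⟧ ρ s p) (⟦rens⟧ ρ ss p)

    mutual
      ⟦sub⟧ : ∀ {Γ Δ σ} (γ : Sub Γ Δ) (s : Tm F Γ σ) {α β} →
              (∀ τ x → shape τ ∋ ⟦ γ τ x ⟧ₜ α ≈ β τ x) →
              shape σ ∋ ⟦ sub γ s ⟧ₜ α ≈ ⟦ s ⟧ₜ β
      ⟦sub⟧ γ (var x) p = p _ x
      ⟦sub⟧ γ (_·_ {σ} {τ} s t) {α} {β} p =
        app-≈ (shape σ) (shape τ) (⟦ sub γ s ⟧ₜ α) (⟦ s ⟧ₜ β) (⟦sub⟧ γ s p) (⟦sub⟧ γ t p)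
      ⟦sub⟧ γ (lam s) {α} p = (λ n → proj₁ (body n)) , (λ n → proj₂ (body n))
        where
        body : ∀ n → _
        body n = ⟦sub⟧ (liftₛ γ) s λ where
          τ here      → ≈-refl (shape τ) n
          -- `γ τ x` has been weakened past the bound variable; its value ignores `n` by the
          -- renaming lemma.
          τ (there x) →
            let q , q′ = ⟦ren⟧ (λ _ → there) (γ τ x) (λ υ y → ≈-refl (shape υ) (α υ y))
                r , r′ = p τ x
            in ⊒-trans (shape τ) q r , ⊒-trans (shape τ) r′ q′
      ⟦sub⟧ γ (fun f ss) p =
        let q , q′ = ⟦subs⟧ γ ss p in
        apply-mono 𝒜 (dom F f) {cod F f} (J f) q , apply-mono 𝒜 (dom F f) {cod F f} (J f) q′

      ⟦subs⟧ : ∀ {Γ Δ σs} (γ : Sub Γ Δ) (ss : All (Tm F Γ) σs) {α β} →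
               (∀ τ x → shape τ ∋ ⟦ γ τ x ⟧ₜ α ≈ β τ x) →
               Args⊒ 𝒜 (⟦ subs γ ss ⟧ₐ α) (⟦ ss ⟧ₐ β) × Args⊒ 𝒜 (⟦ ss ⟧ₐ β) (⟦ subs γ ss ⟧ₐ α)
      ⟦subs⟧ γ []       p = [] , []
      ⟦subs⟧ γ (s ∷ ss) p = Product.zip _∷_ _∷_ (⟦sub⟧ γ s p) (⟦subs⟧ γ ss p)

    ⟦sub⟧-≈ : ∀ {Γ Δ σ} (γ : Sub Γ Δ) (s : Tm F Γ σ) α →
              shape σ ∋ ⟦ sub γ s ⟧ₜ α ≈ ⟦ s ⟧ₜ (λ τ x → ⟦ γ τ x ⟧ₜ α)
    ⟦sub⟧-≈ γ s α = ⟦sub⟧ γ s (λ τ x → ≈-refl (shape τ) _)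

    -- The maximum dominates its first component, the value of `s` with the bound variable sent to
    -- that of `t`; this is the reduct by the substitution lemma.
    ⟦beta⟧ : ∀ {Γ σ τ} (s : Tm F (σ ∷ Γ) τ) (t : Tm F Γ σ) α →
             shape τ ∋ ⟦ lam s · t ⟧ₜ α ⊒ ⟦ s [≔ t ] ⟧ₜ α
    ⟦beta⟧ {σ = σ} {τ} s t α =
      ⊒-trans (shape τ) (max-⊒ (shape τ) _ _) (proj₂ (⟦sub⟧ (instantiate t) s λ where
        υ here      → ≈-refl (shape υ) _
        υ (there x) → ≈-refl (shape υ) _))

    ⟦[]≔⟧-mono : ∀ {Γ σ σs} (ss : All (Tm F Γ) σs) (i : σ ∈ σs) {s t α} →
                 shape σ ∋ ⟦ s ⟧ₜ α ⊒ ⟦ t ⟧ₜ α →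
                 Args⊒ 𝒜 (⟦ ss [ i ]≔ s ⟧ₐ α) (⟦ ss [ i ]≔ t ⟧ₐ α)
    ⟦[]≔⟧-mono (s ∷ ss) (here refl) p = p ∷ Args⊒-refl _
    ⟦[]≔⟧-mono (s ∷ ss) (there i)   p = ⊒-refl _ _ ∷ ⟦[]≔⟧-mono ss i p

    -- The hypothesis ranges over all valuations of the hole's scope, since each abstraction in `C`
    -- extends `α` by an arbitrary value.
    ⟦plug⟧-mono : ∀ {Γ Δ υ σ} (C : Context F Δ υ Γ σ) {s t : Tm F Δ υ} →
                  (∀ α → shape υ ∋ ⟦ s ⟧ₜ α ⊒ ⟦ t ⟧ₜ α) →
                  ∀ α → shape σ ∋ ⟦ plug C s ⟧ₜ α ⊒ ⟦ plug C t ⟧ₜ α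
    ⟦plug⟧-mono □ p α = p α
    ⟦plug⟧-mono (_·ˡ_ {σ = σ} {τ} C u) {s} {t} p α =
      app-mono (shape σ) (shape τ) (⟦ plug C s ⟧ₜ α) (⟦ plug C t ⟧ₜ α)
        (⟦plug⟧-mono C p α) (⊒-refl (shape σ) _)
    ⟦plug⟧-mono (_·ʳ_ {σ = σ} {τ} u C) p α =
      app-mono (shape σ) (shape τ) (⟦ u ⟧ₜ α) (⟦ u ⟧ₜ α)
        (⊒-refl (shape (σ ⇒ τ)) (⟦ u ⟧ₜ α)) (⟦plug⟧-mono C p α)
    ⟦plug⟧-mono (lam C) p α = λ n → ⟦plug⟧-mono C p _
    ⟦plug⟧-mono (fun f ss i C) {s} {t} p α =
      apply-mono 𝒜 (dom F f) {cod F f} (J f)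
        (⟦[]≔⟧-mono ss i {plug C s} {plug C t} (⟦plug⟧-mono C p α))

    -- The two orderings on terms form a reduction pair.

    Geq-trans : ∀ {Γ} (s t u : ∃ (Tm F Γ)) → s ≽ᵍ t → t ≽ᵍ u → s ≽ᵍ u
    Geq-trans (_ , s) _ (υ , u) (e , p) (e′ , q) = trans e e′ , λ α →
      subst (λ x → shape υ ∋ x ⊒ ⟦ u ⟧ₜ α) (sym (subst-trans e e′ (⟦ s ⟧ₜ α)))
        (⊒-trans (shape υ) (subst-⊒ e′ (p α)) (q α))

    Gt-Geq-trans : ∀ {Γ} (s t u : ∃ (Tm F Γ)) → s ≻ᵍ t → t ≽ᵍ u → s ≻ᵍ u
    Gt-Geq-trans (_ , s) _ (υ , u) (e , p) (e′ , q) = trans e e′ , λ α →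
      subst (λ x → shape υ ∋ x ⊐ ⟦ u ⟧ₜ α) (sym (subst-trans e e′ (⟦ s ⟧ₜ α)))
        (⊐-⊒-trans (shape υ) (subst-⊐ e′ (p α)) (q α))

    Gt-trans : ∀ {Γ} (s t u : ∃ (Tm F Γ)) → s ≻ᵍ t → t ≻ᵍ u → s ≻ᵍ u
    Gt-trans (_ , s) _ (υ , u) (e , p) (e′ , q) = trans e e′ , λ α →
      subst (λ x → shape υ ∋ x ⊐ ⟦ u ⟧ₜ α) (sym (subst-trans e e′ (⟦ s ⟧ₜ α)))
        (⊐-trans (shape υ) (subst-⊐ e′ (p α)) (q α))

    value : ∀ {Γ} → ∃ (Tm F Γ) → A
    value (σ , s) = at0⃗ {shape σ} (⟦ s ⟧ₜ (λ τ _ → zeroAt (shape τ)))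

    -- Evaluation at 0⃗ is blind to transport along shape equalities, so terms of different types
    -- are compared within `A`.
    Gt⇒value-> : ∀ {Γ} (s t : ∃ (Tm F Γ)) → s ≻ᵍ t → value s > value t
    Gt⇒value-> _ (τ , t) (e , p) =
      subst (_> _) (at0⃗-subst e _) (at0⃗-mono-> (shape τ) (p _))

    Gt-wellFounded : ∀ {Γ} → WellFounded (flip (_≻ᵍ_ {Γ}))
    Gt-wellFounded =
      Subrelation.wellFounded (λ {s} {t} → Gt⇒value-> t s) (On.wellFounded value >-wellFounded)

    isReductionPair : IsReductionPair (Geq 𝒜 F J) (Gt 𝒜 F J)
    isReductionPair = record
      { quasiOrder  = λ Γ → record
        { isEquivalence = isEquivalence
        ; reflexive     = λ { {σ , s} refl → refl , λ α → ⊒-refl (shape σ) _ }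
        ; trans         = λ {s} {t} {u} → Geq-trans s t u
        }
      ; strictOrder = λ Γ → record
        { isEquivalence = isEquivalence
        ; irrefl        = λ { {s} refl s≻s → >.irrefl refl (Gt⇒value-> s s s≻s) }
        ; trans         = λ {s} {t} {u} → Gt-trans s t u
        ; <-resp-≈      = resp₂ _
        }
      ; wellFounded = λ Γ → Gt-wellFounded
      ; compatible  = inj₁ (λ Γ → Gt-Geq-trans)
      -- The hypothesis is used at the valuation sending each variable `x` to the value of `γ τ x`
      -- under `α`.
      ; ⪰-sub       = λ { {τ = τ} γ s t (e , p) → e , λ α →
          ⊒-trans (shape τ) (subst-⊒ e (proj₁ (⟦sub⟧-≈ γ s α)))
            (⊒-trans (shape τ) (p _) (proj₂ (⟦sub⟧-≈ γ t α))) }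
      ; ≻-sub       = λ { {τ = τ} γ s t (e , p) → e , λ α →
          ⊒-⊐-trans (shape τ) (subst-⊒ e (proj₁ (⟦sub⟧-≈ γ s α)))
            (⊐-⊒-trans (shape τ) (p _) (proj₂ (⟦sub⟧-≈ γ t α))) }
      ; ⪰-mono      = λ { {υ = υ} C s t (e , p) → refl ,
          ⟦plug⟧-mono C (λ α → subst (λ x → shape υ ∋ x ⊒ _) (subst-loop e _) (p α)) }
      ; ⪰-beta      = λ s t → refl , ⟦beta⟧ s t
      }

    -- Iterated application down to base type.

    ⟦·*⟧-mono : ∀ {Γ} σ (s t : Tm F Γ σ) ts α → shape σ ∋ ⟦ s ⟧ₜ α ⊒ ⟦ t ⟧ₜ α →
                ⟦ s ·* ts ⟧ₜ α ≥ ⟦ t ·* ts ⟧ₜ α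
    ⟦·*⟧-mono (base _) s t []       α p = p
    ⟦·*⟧-mono (σ ⇒ τ)  s t (u ∷ ts) α p = ⟦·*⟧-mono τ (s · u) (t · u) ts α
      (app-mono (shape σ) (shape τ) (⟦ s ⟧ₜ α) (⟦ t ⟧ₜ α) p (⊒-refl (shape σ) _))

    -- At each application, discard the second component of the maximum and lower the argument to
    -- zero.
    ⟦·*⟧-≥-head : ∀ {Γ} σ (s : Tm F Γ σ) ts α → ⟦ s ·* ts ⟧ₜ α ≥ at0⃗ {shape σ} (⟦ s ⟧ₜ α)
    ⟦·*⟧-≥-head (base _) s []       α = refl
    ⟦·*⟧-≥-head (σ ⇒ τ)  s (t ∷ ts) α =
      ⊒-trans (base tt) (⟦·*⟧-≥-head τ (s · t) ts α)
        (at0⃗-mono (shape τ) (⊒-trans (shape τ) (max-⊒ (shape τ) _ _)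
          (proj₂ (⟦ s ⟧ₜ α) _ _ (⊒-zeroAt (shape σ) _))))

    -- The argument enters the maximum when it is consumed; the later applications preserve this
    -- bound by `⟦·*⟧-≥-head`.
    ⟦·*⟧-≥-arg : ∀ {Γ} σ {τ} (s : Tm F Γ σ) ts (i : τ ∈ inputs σ) α →
                 ⟦ s ·* ts ⟧ₜ α ≥ at0⃗ {shape τ} (⟦ lookup ts i ⟧ₜ α)
    ⟦·*⟧-≥-arg (σ ⇒ τ) s (t ∷ ts) (here refl) α =
      ⊒-trans (base tt) (⟦·*⟧-≥-head τ (s · t) ts α) (at0⃗-max-≥ (shape τ) _ _)
    ⟦·*⟧-≥-arg (σ ⇒ τ) s (t ∷ ts) (there i) α = ⟦·*⟧-≥-arg τ (s · t) ts i α

    -- A converse to `⟦·*⟧-≥-head` for arguments that are at most zero. The family `c` stands for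
    -- the constants, as the signature is arbitrary here.
    ⟦·*⟧-zeros : (c : ∀ {Γ} σ → Tm F Γ σ) →
                 (∀ {Γ} σ (α : Valuation 𝒜 Γ) → shape σ ∋ zeroAt (shape σ) ⊒ ⟦ c σ ⟧ₜ α) →
                 ∀ {Γ} σ (s : Tm F Γ σ) α →
                 at0⃗ {shape σ} (⟦ s ⟧ₜ α) ≥ ⟦ s ·* universal c (inputs σ) ⟧ₜ α
    ⟦·*⟧-zeros c c≤0 (base _) s α = refl
    ⟦·*⟧-zeros c c≤0 (σ ⇒ τ)  s α =
      ⊒-trans (base tt)
        (at0⃗-mono (shape τ)
          (⊒-trans (shape τ) (⊒-max-𝟎 (shape τ) (proj₁ (⟦ s ⟧ₜ α) (zeroAt (shape σ))))
            -- The `𝟎` in the maximum is read as the value of `zeroAt` at 0⃗; monotonicity of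
            -- application then replaces zero by `c σ`.
            (subst (λ a → shape τ ∋ max (shape τ) (proj₁ (⟦ s ⟧ₜ α) (zeroAt (shape σ))) a ⊒ ⟦ s · c σ ⟧ₜ α)
              (at0⃗-zeroAt (shape σ))
              (app-mono (shape σ) (shape τ) (⟦ s ⟧ₜ α) (⟦ s ⟧ₜ α)
                (⊒-refl (shape (σ ⇒ τ)) (⟦ s ⟧ₜ α)) (c≤0 σ α)))))
        (⟦·*⟧-zeros c c≤0 τ (s · c σ) α)

    -- Brings the arguments of a symbol in `S` into the form to which the hypothesis on `S` applies.
    ⟦⟧*-⊒-zeros[]≔ : ∀ {Γ σ σs} (ss : All (Tm F Γ) σs) (i : σ ∈ σs) α →
                     Args⊒ 𝒜 (⟦ ss ⟧ₐ α) (zeros 𝒜 σs [ i ]≔ ⟦ lookup ss i ⟧ₜ α)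
    ⟦⟧*-⊒-zeros[]≔ (s ∷ ss) (here refl) α = ⊒-refl _ _ ∷ Args⊒-zeros _
    ⟦⟧*-⊒-zeros[]≔ (s ∷ ss) (there i)   α = ⊒-zeroAt _ _ ∷ ⟦⟧*-⊒-zeros[]≔ ss i α

  -- Respecting the relation `▷ˢ`.

  module _ {B : Set} (R : RewriteSystem B) (v : Variant) (J : Interpretation 𝒜 (ExtSig R v))
    (const-zero : ∀ σ → shape σ ∋ J (const σ) ≐ zeroAt (shape σ))
    (S-subterm : ∀ f → InS R v f → ∀ σ (i : σ ∈ extDom R f) (n : WM (shape σ)) →
      at0⃗ {shape (extCod R f)}
        (apply 𝒜 (extDom R f) {extCod R f} (J f) (zeros 𝒜 (extDom R f) [ i ]≔ n))
      ≥ at0⃗ {shape σ} n)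
    where
    private
      F = ExtSig R v

      ⟦_⟧ₜ : ∀ {Γ σ} → Tm F Γ σ → Valuation 𝒜 Γ → WM (shape σ)
      ⟦_⟧ₜ = ⟦_⟧ 𝒜 F J

    ⟦·c⃗⟧-≤ : ∀ {Γ σ} (s : Tm F Γ σ) α → at0⃗ {shape σ} (⟦ s ⟧ₜ α) ≥ ⟦ _·c⃗ R v s ⟧ₜ α
    ⟦·c⃗⟧-≤ {σ = σ} s α =
      ⟦·*⟧-zeros F J (λ σ → fun (const σ) []) (λ σ _ → ≐⇒⊑ (shape σ) (const-zero σ)) σ s α

    mutual
      ▷ˢ⇒≥ : ∀ {Γ} {s u : BaseTm R v Γ} → _▷ˢ_ R v s u →
             ∀ α → ⟦ proj₂ s ⟧ₜ α ≥ ⟦ proj₂ u ⟧ₜ α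
      ▷ˢ⇒≥ (beta {τ = τ} s t ts p) α =
        ⊒-trans (base tt)
          (⟦·*⟧-mono F J τ (lam s · t) (s [≔ t ]) ts α (⟦beta⟧ F J s t α))
          (⊵ˢ⇒≥ p α)
      ▷ˢ⇒≥ (inFun {f} {σ} f∈S ss ts i p) α =
        -- Drop `ts`, lower all arguments but the one at `i` to zero, apply the hypothesis on `S`,
        -- pass to the application to constants, and recurse.
        ⊒-trans (base tt) (⟦·*⟧-≥-head F J (extCod R f) (fun f ss) ts α)
        (⊒-trans (base tt)
          (at0⃗-mono (shape (extCod R f))
            (apply-mono 𝒜 (extDom R f) {extCod R f} (J f) (⟦⟧*-⊒-zeros[]≔ F J ss i α)))
        (⊒-trans (base tt) (S-subterm f f∈S σ i _)
        (⊒-trans (base tt) (⟦·c⃗⟧-≤ (lookup ss i) α) (⊵ˢ⇒≥ p α))))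
      ▷ˢ⇒≥ (inArg {σ} s ts i p) α =
        ⊒-trans (base tt) (⟦·*⟧-≥-arg F J σ s ts i α)
        (⊒-trans (base tt) (⟦·c⃗⟧-≤ (lookup ts i) α) (⊵ˢ⇒≥ p α))

      ⊵ˢ⇒≥ : ∀ {Γ} {s u : BaseTm R v Γ} → _⊵ˢ_ R v s u →
             ∀ α → ⟦ proj₂ s ⟧ₜ α ≥ ⟦ proj₂ u ⟧ₜ α
      ⊵ˢ⇒≥ [ p ] α = ▷ˢ⇒≥ p α
      ⊵ˢ⇒≥ refl  α = refl

    respectsSubterm : RespectsSubterm R v (Geq 𝒜 F J) (Gt 𝒜 F J)
    -- One `⪰` step suffices; `refl` works even for distinct base types, since all have the same
    -- shape.
    respectsSubterm Γ s u p = inj₁ (refl , ▷ˢ⇒≥ p) ◅ ε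

theorem7p4 : {B : Set} (R : RewriteSystem B) (v : Variant)
    (𝒜 : Domain) (let open Functionals 𝒜) (J : Interpretation 𝒜 (ExtSig R v)) →
    (∀ σ → shape σ ∋ J (const σ) ≐ zeroAt (shape σ)) →
    (∀ f → InS R v f → ∀ σ (i : σ ∈ extDom R f) (n : WM (shape σ)) →
    at0⃗ {shape (extCod R f)}
    (apply 𝒜 (extDom R f) {extCod R f} (J f) (zeros 𝒜 (extDom R f) [ i ]≔ n))
    ≥ at0⃗ {shape σ} n) →
    IsReductionPair (Geq 𝒜 (ExtSig R v) J) (Gt 𝒜 (ExtSig R v) J)
    × RespectsSubterm R v (Geq 𝒜 (ExtSig R v) J) (Gt 𝒜 (ExtSig R v) J)
theorem7p4 R v 𝒜 J const-zero S-subterm =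
  isReductionPair 𝒜 (ExtSig R v) J , respectsSubterm 𝒜 R v J const-zero S-subterm
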